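{- Let $N\ge 2$ and $m\ge 1$ be integers and let $x^{(r,s)}_k$ ($1\le r,s\le N$, $1\le k\le m$) be elements of a commutative ring; set $x^{(r,s)}_{m+1}=0$ for all $1\le r,s\le N$. Let $C(N,m)$ be the $Nm\times Nm$ matrix which, as an $N\times N$ block matrix with $m\times m$ blocks, has $(r,s)$ block $C_m(x^{(r,s)}_1,\dots,x^{(r,s)}_m)$. Then $$\det(C(N,m))=\begin{cases}(-1)^{\frac{Nm}{2}}\prod_{i=1}^{m}\det(X_{(i,i+1)}), & \text{if } m \text{ is even},\\[2pt] (-1)^{\frac{N(m-1)}{2}}\prod_{i=1}^{m}\det(X_{(i,i+1)}), & \text{if } m \text{ is odd}.\end{cases}$$
   Context: For elements $x_1,\dots,x_m$, $C_m(x_1,\dots,x_m)$ is the $m\times m$ matrix whose $(p,q)$ entry is $x_{\max(p,\,m+1-q)}$ (top-right entry $x_1$, first column and last row constantly $x_m$). For $1\le i\le m$, $X_{(i,i+1)}$ is the $N\times N$ matrix whose $(r,s)$ entry is $x^{(r,s)}_i-x^{(r,s)}_{i+1}$. -}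

module Defs where

open import Algebra.Bundles using (CommutativeRing; Semiring)
import Algebra.Construct.NaturalChoice.Max as Max
import Algebra.Definitions.RawSemiring as RawSemiringDefs
open import Data.Fin.Base using (Fin; zero; suc; toℕ; fromℕ; inject₁; opposite; quotient; remainder)
open import Data.Fin.Properties using (≤-totalOrder)
open import Data.Nat.Base using (ℕ; zero; suc) renaming (_*_ to _*ℕ_)
open import Data.Vec.Functional using (Vector; removeAt; insertAt)

module Matrices {c ℓ} (R : CommutativeRing c ℓ) where

  open CommutativeRing R hiding (zero)
  open RawSemiringDefs (Semiring.rawSemiring semiring) public using (sum; product; _^_)

  SquareMatrix : ℕ → Set c
  SquareMatrix n = Vector (Vector Carrier n) n

  -- Laplace expansion along the first row; the empty determinant is 1.
  det : ∀ {n} → SquareMatrix n → Carrier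
  det {zero}  A = 1#
  det {suc n} A =
    sum λ j → (- 1#) ^ toℕ j * (A zero j * det (λ i → removeAt (A (suc i)) j))

  -- Indices are 0-based throughout: the element written x_k (1 ≤ k ≤ m) is
  -- x at position k - 1.  Since opposite q = m - 1 - q, the 1-based index
  -- max(p, m + 1 - q) is p ⊔ opposite q in 0-based terms.
  C : ∀ {m} → Vector Carrier m → SquareMatrix m
  C {m} x p q = x (p ⊔ opposite q)
    where open Max (≤-totalOrder m) using (_⊔_)

  -- Position a of the Nm positions is row/column (remainder m a) of
  -- block-row/block-column (quotient m a), i.e. a = quotient · m + remainder.
  blockMatrix : ∀ {N m} → (Fin N → Fin N → SquareMatrix m) → SquareMatrix (N *ℕ m)
  blockMatrix {N} {m} B a b =
    B (quotient m a) (quotient m b) (remainder {N} m a) (remainder {N} m b)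

  CN : ∀ {N m} → (Fin N → Fin N → Vector Carrier m) → SquareMatrix (N *ℕ m)
  CN x = blockMatrix λ r s → C (x r s)

  -- The sequence x₁, …, x_m followed by x_{m+1} = 0.
  extend : ∀ {m} → Vector Carrier m → Vector Carrier (suc m)
  extend {m} x = insertAt x (fromℕ m) 0#

  -- X x i is the matrix X_{(i+1,i+2)} in 1-based notation.
  X : ∀ {N m} → (Fin N → Fin N → Vector Carrier m) → Fin m → SquareMatrix N
  X x i r s = extend (x r s) (inject₁ i) - extend (x r s) (suc i)

{-# OPTIONS --safe #-}

-- Put U[p,i] = [p ≤ i], L[i,q] = [m+1-q ≤ i] and dᵢ = xᵢ - xᵢ₊₁.  Telescoping
-- x_u = Σ_{i ≥ u} dᵢ gives C_m(x) = U · diag(d₁, …, d_m) · L, whence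
-- C(N,m) = (I ⊗ U) · D · (I ⊗ L), where D is the direct sum of the X_(i,i+1) once
-- the indices (r,i) are grouped by i rather than by r.  A form that is multilinear
-- and alternating in the rows of each of several blocks is a multiple of the product
-- of the determinants of the blocks; hence each factor contributes such a product,
-- whichever way the rows are grouped, and no permutation sign has to be tracked.
-- Finally det U = 1, and det L = (-1)^⌊m/2⌋ by Laplace expansion.
module Submission where

open import Defs
open import Algebra.Bundles using (CommutativeRing)
import Algebra.Construct.NaturalChoice.Max as Max
open import Data.Fin.Base using (Fin; zero; suc; toℕ; fromℕ; inject₁; opposite; punchIn) renaming (_≤_ to _≤ᶠ_)
open import Data.Fin.Induction using (<-weakInduction)
open import Data.Fin.Properties
  using (_≟_; suc-injective; punchInᵢ≢i; toℕ-fromℕ; toℕ-inject₁; opposite-involutive; ≤-total; ≤-totalOrder; *↔×)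
open import Data.Nat.Base using (ℕ; zero; suc; s≤s; _≤_; _∸_; _/_) renaming (_*_ to _*ℕ_)
open import Data.Nat.Divisibility using (_∣_; _∤_; divides)
open import Data.Nat.DivMod using (m*n/n≡m)
import Data.Nat.Properties as ℕ
open import Data.Product.Algebra using (×-comm)
open import Data.Product.Base using (_×_; _,_; proj₁; proj₂; ∃)
open import Data.Sum.Base using (_⊎_; inj₁; inj₂)
open import Data.Vec.Functional using (Vector; _∷_; head; tail; removeAt; insertAt; updateAt)
open import Data.Vec.Functional.Properties
  using (updateAt-updates; updateAt-minimal; updateAt-commutes; insertAt-punchIn; insertAt-lookup)
open import Function.Base using (_∘_; const)
open import Function.Bundles using (_↔_; Inverse)
open import Function.Construct.Composition using (_↔-∘_)
open import Level using () renaming (_⊔_ to _⊔ˡ_)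
open import Relation.Binary.Core using (Rel)
open import Relation.Binary.PropositionalEquality as ≡ using (_≡_; _≢_; _≗_)
open import Relation.Nullary using (yes; no; contradiction)

module Determinants {c ℓ} (R : CommutativeRing c ℓ) where

  open CommutativeRing R hiding (zero)
  open Matrices R hiding (sum; det)
  open import Algebra.Properties.Group +-group using (inverseˡ-unique; ⁻¹-involutive; ε⁻¹≈ε)
  open import Algebra.Properties.Monoid.Sum *-monoid using ()
    renaming (sum-cong-≋ to product-cong; sum-replicate to product-replicate)
  open import Algebra.Properties.Ring ring using (-1*x≈-x)
  open import Algebra.Properties.Semiring.Exp semiring using (^-congˡ; ^-assocʳ)
  open import Algebra.Properties.Semiring.Sum semiring
    using (sum; sum-cong-≋; sum-remove; sum-replicate-zero; ∑-distrib-+; *-distribˡ-sum; *-distribʳ-sum)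
  open import Algebra.Solver.Ring.NaturalCoefficients.Default commutativeSemiring
    using (solve; _:*_; _:+_; _:=_)
  open import Data.Vec.Functional.Relation.Binary.Equality.Setoid setoid
    using (_≋_; ≋-refl; ≋-reflexive; ≋-sym; ≋-trans)
  open import Relation.Binary.Reasoning.Setoid setoid

  -- Finite sums and Laplace expansion

  -- Opacity keeps the length-recursive sum and det from unfolding during unification.
  opaque
    ∑ : ∀ {n} → Vector Carrier n → Carrier
    ∑ = sum

    det : ∀ {n} → SquareMatrix n → Carrier
    det = Matrices.det R

  opaque
    unfolding ∑ det

    ∑-empty : (t : Vector Carrier 0) → ∑ t ≈ 0#
    ∑-empty t = refl

    ∑-suc : ∀ {n} (t : Vector Carrier (suc n)) → ∑ t ≈ head t + ∑ (tail t)
    ∑-suc t = refl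

    ∑-cong : ∀ {n} {s t : Vector Carrier n} → s ≋ t → ∑ s ≈ ∑ t
    ∑-cong = sum-cong-≋

    ∑-zero : ∀ {n} {t : Vector Carrier n} → (∀ i → t i ≈ 0#) → ∑ t ≈ 0#
    ∑-zero {n} t≈0 = trans (sum-cong-≋ t≈0) (sum-replicate-zero n)

    ∑-single : ∀ {n} i {t : Vector Carrier n} → (∀ j → j ≢ i → t j ≈ 0#) → ∑ t ≈ t i
    ∑-single {suc n} i {t} t≈0 = begin
      sum t                      ≈⟨ sum-remove t ⟩
      t i + sum (removeAt t i)   ≈⟨ +-congˡ (∑-zero λ j → t≈0 (punchIn i j) (punchInᵢ≢i i j)) ⟩
      t i + 0#                   ≈⟨ +-identityʳ _ ⟩
      t i                        ∎

    ∑-+ : ∀ {n} (s t : Vector Carrier n) → ∑ (λ i → s i + t i) ≈ ∑ s + ∑ t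
    ∑-+ = ∑-distrib-+

    ∑-*ˡ : ∀ {n} a (t : Vector Carrier n) → a * ∑ t ≈ ∑ (λ i → a * t i)
    ∑-*ˡ = *-distribˡ-sum

    ∑-*ʳ : ∀ {n} a (t : Vector Carrier n) → ∑ t * a ≈ ∑ (λ i → t i * a)
    ∑-*ʳ = *-distribʳ-sum

    det-≡ : ∀ {n} (A : SquareMatrix n) → Matrices.det R A ≡ det A
    det-≡ A = ≡.refl

    det-empty : (A : SquareMatrix 0) → det A ≈ 1#
    det-empty A = refl

    laplace : ∀ {n} (A : SquareMatrix (suc n)) →
              det A ≈ ∑ λ j → (- 1#) ^ toℕ j * (A zero j * det (λ i → removeAt (A (suc i)) j))
    laplace A = refl

  -- Multilinear and alternating forms

  -- Rows are indexed by an arbitrary set, so that pairs (block, row) are allowed. In `linear` the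
  -- three families are compared off row `i` rather than built by updating it, so `I` needs no
  -- decidable equality; the one law covers additivity and scaling.
  record Multilinear {I : Set} {n} (f : (I → Vector Carrier n) → Carrier) : Set (c ⊔ˡ ℓ) where
    field
      cong   : ∀ {A B} → (∀ i → A i ≋ B i) → f A ≈ f B
      linear : ∀ i a {A B M} →
               (∀ k → k ≢ i → A k ≋ M k) → (∀ k → k ≢ i → B k ≋ M k) →
               (∀ j → M i j ≈ a * A i j + B i j) →
               f M ≈ a * f A + f B

    -- A zero row equals - 1# times itself plus itself, so linearity with all three families equal
    -- to `M` gives `f M ≈ - f M + f M`.
    zero-row : ∀ i {M} → (∀ j → M i j ≈ 0#) → f M ≈ 0#
    zero-row i {M} Mi≈0 = begin
      f M                   ≈⟨ linear i (- 1#) (λ _ _ → ≋-refl) (λ _ _ → ≋-refl) row ⟩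
      - 1# * f M + f M      ≈⟨ +-congʳ (-1*x≈-x _) ⟩
      - f M + f M           ≈⟨ -‿inverseˡ _ ⟩
      0#                    ∎
      where
      row : ∀ j → M i j ≈ - 1# * M i j + M i j
      row j = trans (Mi≈0 j) (sym (trans (+-congʳ (-1*x≈-x _)) (-‿inverseˡ _)))

  -- Stated for one pair of rows, so that `swap-rows` is available for a pair already treated while
  -- vanishing for other pairs is still being proved.
  EqualRowsVanish : {I : Set} {n : ℕ} → ((I → Vector Carrier n) → Carrier) → I → I → Set (c ⊔ˡ ℓ)
  EqualRowsVanish f i j = ∀ {A} → A i ≋ A j → f A ≈ 0#

  record Alternating {n} (f : SquareMatrix n → Carrier) : Set (c ⊔ˡ ℓ) where
    field
      multilinear : Multilinear f
      vanish      : ∀ {i j} → i ≢ j → EqualRowsVanish f i j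
    open Multilinear multilinear public

  module _ {m n} {f : (Fin m → Vector Carrier n) → Carrier} (multilinear : Multilinear f)
           {i j : Fin m} (i≢j : i ≢ j) (vanish : EqualRowsVanish f i j) where
    open Multilinear multilinear

    -- Polarisation: put the sum `s` of the two rows in both places. The form vanishes there, and of
    -- the four terms of its expansion the two with a repeated row vanish as well.
    swap-rows : ∀ {A B} → A i ≋ B j → A j ≋ B i →
                (∀ k → k ≢ i → k ≢ j → A k ≋ B k) → f A ≈ - f B
    swap-rows {A} {B} Ai≋Bj Aj≋Bi A≋B = inverseˡ-unique _ _ (begin
      f A + f B
        ≈⟨ +-cong (cong λ k → ≋-sym (rows≋ {A} ≋-refl ≋-refl (λ _ _ _ → ≋-refl) k)) (cong λ k → ≋-sym (rows≋ Aj≋Bi Ai≋Bj A≋B k)) ⟩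
      f (rows u v) + f (rows v u)                     ≈⟨ +-cong (+-identityˡ _) (+-identityʳ _) ⟨
      (0# + f (rows u v)) + (f (rows v u) + 0#)
        ≈⟨ +-cong (+-congʳ (diagonal u)) (+-congˡ (diagonal v)) ⟨
      (f (rows u u) + f (rows u v)) + (f (rows v u) + f (rows v v))
        ≈⟨ +-cong (additiveʳ u) (additiveʳ v) ⟨
      f (rows u s) + f (rows v s)
        ≈⟨ trans (linear i 1# (offᵢ u s) (offᵢ v s) rowᵢ) (+-congʳ (*-identityˡ _)) ⟨
      f (rows s s)                                    ≈⟨ diagonal s ⟩
      0#                                              ∎)
      where
      u v s : Vector Carrier n
      u = A i
      v = A j
      s k = u k + v k

      rows : Vector Carrier n → Vector Carrier n → Fin m → Vector Carrier n
      rows y z = updateAt (updateAt A j (const z)) i (const y)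

      rows-i : ∀ y z → rows y z i ≡ y
      rows-i y z = updateAt-updates i _

      rows-j : ∀ y z → rows y z j ≡ z
      rows-j y z = ≡.trans (updateAt-minimal j i _ (i≢j ∘ ≡.sym)) (updateAt-updates j _)

      rows≋ : ∀ {M y z} → y ≋ M i → z ≋ M j → (∀ k → k ≢ i → k ≢ j → A k ≋ M k) →
              ∀ k → rows y z k ≋ M k
      rows≋ {M} {y} {z} y≋ z≋ A≋ k with k ≟ i | k ≟ j
      ... | yes ≡.refl | _          = ≋-trans (≋-reflexive (rows-i y z)) y≋
      ... | no _       | yes ≡.refl = ≋-trans (≋-reflexive (rows-j y z)) z≋
      ... | no k≢i     | no k≢j     = ≋-trans (≋-reflexive
        (≡.trans (updateAt-minimal k i _ k≢i) (updateAt-minimal k j _ k≢j))) (A≋ k k≢i k≢j)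

      diagonal : ∀ y → f (rows y y) ≈ 0#
      diagonal y = vanish (≋-reflexive (≡.trans (rows-i y y) (≡.sym (rows-j y y))))

      offᵢ : ∀ y z {y′} k → k ≢ i → rows y z k ≋ rows y′ z k
      offᵢ y z k k≢i = ≋-reflexive
        (≡.trans (updateAt-minimal k i _ k≢i) (≡.sym (updateAt-minimal k i _ k≢i)))

      offⱼ : ∀ y z {z′} k → k ≢ j → rows y z k ≋ rows y z′ k
      offⱼ y z k k≢j = ≋-reflexive (≡.trans (commute z)
        (≡.trans (updateAt-minimal k j _ k≢j)
          (≡.sym (≡.trans (commute _) (updateAt-minimal k j _ k≢j)))))
        where
        commute : ∀ w → rows y w k ≡ updateAt (updateAt A i (const y)) j (const w) k
        commute w = updateAt-commutes i j i≢j _ k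

      rowᵢ : ∀ k → rows s s i k ≈ 1# * rows u s i k + rows v s i k
      rowᵢ k rewrite rows-i s s | rows-i u s | rows-i v s = +-congʳ (sym (*-identityˡ _))

      rowⱼ : ∀ y k → rows y s j k ≈ 1# * rows y u j k + rows y v j k
      rowⱼ y k rewrite rows-j y s | rows-j y u | rows-j y v = +-congʳ (sym (*-identityˡ _))

      additiveʳ : ∀ y → f (rows y s) ≈ f (rows y u) + f (rows y v)
      additiveʳ y = trans (linear j 1# (offⱼ y u) (offⱼ y v) (rowⱼ y)) (+-congʳ (*-identityˡ _))

  -- The determinant is alternating

  det-cong : ∀ {n} {A B : SquareMatrix n} → (∀ i → A i ≋ B i) → det A ≈ det B
  det-cong {zero}  A≋B = trans (det-empty _) (sym (det-empty _))
  det-cong {suc n} {A} {B} A≋B = begin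
    det A   ≈⟨ laplace A ⟩
    ∑ _
      ≈⟨ ∑-cong (λ j → *-congˡ (*-cong (A≋B zero j) (det-cong λ i k → A≋B (suc i) (punchIn j k)))) ⟩
    ∑ _     ≈⟨ laplace B ⟨
    det B   ∎

  -- Each Laplace summand is linear in row `i`: through its entry when `i` is the first row,
  -- otherwise through its minor, by induction on the size.
  det-linear : ∀ {n} (i : Fin n) a {A B M : SquareMatrix n} →
               (∀ k → k ≢ i → A k ≋ M k) → (∀ k → k ≢ i → B k ≋ M k) →
               (∀ j → M i j ≈ a * A i j + B i j) →
               det M ≈ a * det A + det B
  det-linear {suc n} i a {A} {B} {M} A≋M B≋M row = begin
    det M                                         ≈⟨ laplace M ⟩
    ∑ (summand M)                                 ≈⟨ ∑-cong (term i A≋M B≋M row) ⟩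
    ∑ (λ j → a * summand A j + summand B j)       ≈⟨ ∑-+ _ _ ⟩
    ∑ (λ j → a * summand A j) + ∑ (summand B)     ≈⟨ +-cong (∑-*ˡ a _) (laplace B) ⟨
    a * ∑ (summand A) + det B                     ≈⟨ +-congʳ (*-congˡ (laplace A)) ⟨
    a * det A + det B                             ∎
    where
    minor : SquareMatrix (suc n) → Fin (suc n) → SquareMatrix n
    minor M j k = removeAt (M (suc k)) j

    summand : SquareMatrix (suc n) → Fin (suc n) → Carrier
    summand M j = (- 1#) ^ toℕ j * (M zero j * det (minor M j))

    term : ∀ i → (∀ k → k ≢ i → A k ≋ M k) → (∀ k → k ≢ i → B k ≋ M k) →
           (∀ j → M i j ≈ a * A i j + B i j) →
           ∀ j → summand M j ≈ a * summand A j + summand B j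
    term zero A≋M B≋M row j = begin
      s * (M zero j * d)                            ≈⟨ *-congˡ (*-congʳ (row j)) ⟩
      s * ((a * A zero j + B zero j) * d)
        ≈⟨ solve 5 (λ s a x y d → s :* ((a :* x :+ y) :* d) := a :* (s :* (x :* d)) :+ s :* (y :* d)) refl s a (A zero j) (B zero j) d ⟩
      a * (s * (A zero j * d)) + s * (B zero j * d)
        ≈⟨ +-cong (*-congˡ (*-congˡ (*-congˡ (minor≈ A≋M)))) (*-congˡ (*-congˡ (minor≈ B≋M))) ⟨
      a * summand A j + summand B j                 ∎
      where
      s d : Carrier
      s = (- 1#) ^ toℕ j
      d = det (minor M j)
      minor≈ : ∀ {A} → (∀ k → k ≢ zero → A k ≋ M k) → det (minor A j) ≈ d
      minor≈ A≋M = det-cong λ k l → A≋M (suc k) (λ ()) (punchIn j l)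
    term (suc i) A≋M B≋M row j = begin
      s * (x * det (minor M j))
        ≈⟨ *-congˡ (*-congˡ (det-linear i a (minor≋ A≋M) (minor≋ B≋M) (row ∘ punchIn j))) ⟩
      s * (x * (a * d + e))
        ≈⟨ solve 5 (λ s a x d e → s :* (x :* (a :* d :+ e)) := a :* (s :* (x :* d)) :+ s :* (x :* e)) refl s a x d e ⟩
      a * (s * (x * d)) + s * (x * e)
        ≈⟨ +-cong (*-congˡ (*-congˡ (*-congʳ (A≋M zero (λ ()) j)))) (*-congˡ (*-congʳ (B≋M zero (λ ()) j))) ⟨
      a * summand A j + summand B j           ∎
      where
      s x d e : Carrier
      s = (- 1#) ^ toℕ j
      x = M zero j
      d = det (minor A j)
      e = det (minor B j)
      minor≋ : ∀ {A} → (∀ k → k ≢ suc i → A k ≋ M k) →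
               ∀ k → k ≢ i → minor A j k ≋ minor M j k
      minor≋ A≋M k k≢i = A≋M (suc k) (k≢i ∘ suc-injective) ∘ punchIn j

  det-multilinear : ∀ {n} → Multilinear (det {n})
  det-multilinear = record { cong = det-cong ; linear = det-linear }

  -- Isolates the pairs of choices in which one of two rows uses column zero: (zero, k) and (suc k,
  -- zero) select the same two columns in opposite order.
  cancel-border : ∀ {n} (G : Fin (suc (suc n)) → Fin (suc n) → Carrier) →
                  (∀ k → G zero k + G (suc k) zero ≈ 0#) →
                  ∑ (λ j → ∑ (G j)) ≈ ∑ (λ j → ∑ (G (suc j) ∘ suc))
  cancel-border G G≈0 = begin
    ∑ (λ j → ∑ (G j))
      ≈⟨ ∑-suc _ ⟩
    ∑ (G zero) + ∑ (λ j → ∑ (G (suc j)))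
      ≈⟨ +-congˡ (∑-cong λ j → ∑-suc (G (suc j))) ⟩
    ∑ (G zero) + ∑ (λ j → G (suc j) zero + ∑ (G (suc j) ∘ suc))
      ≈⟨ +-congˡ (∑-+ (λ j → G (suc j) zero) _) ⟩
    ∑ (G zero) + (∑ (λ j → G (suc j) zero) + rest)
      ≈⟨ +-assoc _ _ _ ⟨
    (∑ (G zero) + ∑ (λ j → G (suc j) zero)) + rest
      ≈⟨ +-congʳ (∑-+ (G zero) _) ⟨
    ∑ (λ j → G zero j + G (suc j) zero) + rest
      ≈⟨ +-congʳ (∑-zero G≈0) ⟩
    0# + rest
      ≈⟨ +-identityˡ _ ⟩
    rest ∎
    where
    rest : Carrier
    rest = ∑ (λ j → ∑ (G (suc j) ∘ suc))

  -- Two Laplace expansions along equal rows u; φ stands for the complementary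
  -- minor as a function of the remaining columns.
  double-expansion-vanishes :
    ∀ {n} (u : Vector Carrier (suc (suc n))) (φ : (Fin n → Fin (suc (suc n))) → Carrier) →
    (∀ {g h} → g ≗ h → φ g ≈ φ h) →
    ∑ (λ j → ∑ λ k → (- 1#) ^ toℕ j * (u j * ((- 1#) ^ toℕ k *
      (u (punchIn j k) * φ (punchIn j ∘ punchIn k))))) ≈ 0#
  double-expansion-vanishes {n} u φ φ-cong = trans (cancel-border G border) (rest n u φ φ-cong)
    where
    G : Fin (suc (suc n)) → Fin (suc n) → Carrier
    G j k = (- 1#) ^ toℕ j * (u j * ((- 1#) ^ toℕ k * (u (punchIn j k) * φ (punchIn j ∘ punchIn k))))

    border : ∀ k → G zero k + G (suc k) zero ≈ 0#
    border k = begin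
      1# * (x * (s * (y * d))) + (- 1# * s) * (y * (1# * (x * φ (punchIn (suc k) ∘ suc))))
        ≈⟨ +-cong (*-identityˡ _) (*-congˡ (*-congˡ (trans (*-identityˡ _) (*-congˡ (φ-cong λ _ → ≡.refl))))) ⟩
      x * (s * (y * d)) + (- 1# * s) * (y * (x * d))
        -- Both products use columns zero and `suc k`; the second carries one more factor - 1#.
        ≈⟨ +-congˡ (solve 5 (λ e s x y d → (e :* s) :* (y :* (x :* d)) := e :* (x :* (s :* (y :* d)))) refl (- 1#) s x y d) ⟩
      x * (s * (y * d)) + - 1# * (x * (s * (y * d)))
        ≈⟨ +-congˡ (-1*x≈-x _) ⟩
      x * (s * (y * d)) - x * (s * (y * d))
        ≈⟨ -‿inverseʳ _ ⟩
      0# ∎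
      where
      s x y d : Carrier
      s = (- 1#) ^ toℕ k
      x = u zero
      y = u (suc k)
      d = φ (suc ∘ punchIn k)

    rest : ∀ n (u : Vector Carrier (suc (suc n))) (φ : (Fin n → Fin (suc (suc n))) → Carrier) →
      (∀ {g h} → g ≗ h → φ g ≈ φ h) →
      ∑ (λ j → ∑ λ k → (- 1#) ^ toℕ (suc j) * (u (suc j) * ((- 1#) ^ toℕ (suc k) *
        (u (punchIn (suc j) (suc k)) * φ (punchIn (suc j) ∘ punchIn (suc k)))))) ≈ 0#
    -- Only two columns exist, so none is left for the second row once column zero is excluded.
    rest zero    u φ φ-cong = ∑-zero λ _ → ∑-empty _
    rest (suc n) u φ φ-cong = trans
      (∑-cong λ j → ∑-cong λ k → begin
        (- 1# * s j) * (v j * ((- 1# * s k) * (v (punchIn j k) * φ (punchIn (suc j) ∘ punchIn (suc k)))))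
          -- Neither row uses column zero, so it always remains for the complementary minor; `shift`
          -- puts it back in front. The two selections of columns agree only pointwise, hence the
          -- appeal to `φ-cong`.
          ≈⟨ *-congˡ (*-congˡ (*-congˡ (*-congˡ (φ-cong λ { zero → ≡.refl ; (suc l) → ≡.refl })))) ⟩
        (- 1# * s j) * (v j * ((- 1# * s k) * (v (punchIn j k) * φ (shift (punchIn j ∘ punchIn k)))))
          ≈⟨ solve 6 (λ e s x t y d → (e :* s) :* (x :* ((e :* t) :* (y :* d))) := (e :* e) :* (s :* (x :* (t :* (y :* d))))) refl (- 1#) (s j) (v j) (s k) (v (punchIn j k)) _ ⟩
        (- 1# * - 1#) * (s j * (v j * (s k * (v (punchIn j k) * φ (shift (punchIn j ∘ punchIn k))))))
          ∎)
      -- The two extra signs come out as a common factor, leaving the same double sum for the tail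
      -- of `u`.
      (trans (∑-cong λ j → sym (∑-*ˡ (- 1# * - 1#) _))
        (trans (sym (∑-*ˡ (- 1# * - 1#) _))
          (trans (*-congˡ (double-expansion-vanishes v (φ ∘ shift)
            (λ g≗h → φ-cong λ { zero → ≡.refl ; (suc l) → ≡.cong suc (g≗h l) })))
            (zeroʳ _))))
      where
      s : ∀ {m} → Fin m → Carrier
      s j = (- 1#) ^ toℕ j
      v : Vector Carrier (suc (suc n))
      v = u ∘ suc
      shift : (Fin n → Fin (suc (suc n))) → Fin (suc n) → Fin (suc (suc (suc n)))
      shift h = zero ∷ (suc ∘ h)

  -- After two expansions the complementary minor depends only on which columns remain, so it can
  -- serve as `φ` in `double-expansion-vanishes`.
  det-vanish₀₁ : ∀ {n} {A : SquareMatrix (suc (suc n))} → A zero ≋ A (suc zero) → det A ≈ 0#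
  det-vanish₀₁ {n} {A} A₀≋A₁ = begin
    det A
      ≈⟨ laplace A ⟩
    ∑ (λ j → s j * (A zero j * det (λ i → removeAt (A (suc i)) j)))
      ≈⟨ ∑-cong (λ j → *-congˡ (*-congˡ (laplace _))) ⟩
    ∑ (λ j → s j * (A zero j * ∑ (λ k → s k * (A (suc zero) (punchIn j k) * minor (punchIn j ∘ punchIn k)))))
      ≈⟨ ∑-cong (λ j → *-congˡ (*-congˡ (∑-cong λ k → *-congˡ (*-congʳ (A₀≋A₁ (punchIn j k)))))) ⟨
    ∑ (λ j → s j * (A zero j * ∑ (λ k → s k * (A zero (punchIn j k) * minor (punchIn j ∘ punchIn k)))))
      ≈⟨ ∑-cong (λ j → trans (*-congˡ (∑-*ˡ (A zero j) _)) (∑-*ˡ (s j) _)) ⟩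
    ∑ (λ j → ∑ λ k → s j * (A zero j * (s k * (A zero (punchIn j k) * minor (punchIn j ∘ punchIn k)))))
      ≈⟨ double-expansion-vanishes (A zero) minor (λ g≗h → det-cong λ i l → reflexive (≡.cong (A (suc (suc i))) (g≗h l))) ⟩
    0# ∎
    where
    s : ∀ {m} → Fin m → Carrier
    s j = (- 1#) ^ toℕ j
    minor : (Fin n → Fin (suc (suc n))) → Carrier
    minor h = det λ i → A (suc (suc i)) ∘ h

  minors-vanish : ∀ {n} {A : SquareMatrix (suc n)} →
                  (∀ j → det (λ i → removeAt (A (suc i)) j) ≈ 0#) → det A ≈ 0#
  minors-vanish minor≈0 =
    trans (laplace _) (∑-zero λ j → trans (*-congˡ (trans (*-congˡ (minor≈0 j)) (zeroʳ _))) (zeroʳ _))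

  -- Two equal rows below the first survive in every minor; a pair containing the first row is left
  -- to `det-vanish₀`, which returns to smaller matrices.
  det-vanish : ∀ {n} {i j : Fin n} → i ≢ j → EqualRowsVanish det i j

  -- Exchanging the first two rows moves row zero below the top, after which every minor along the
  -- first row contains both equal rows. The exchange itself rests on the adjacent case
  -- `det-vanish₀₁`.
  det-vanish₀ : ∀ {n} (j : Fin n) → EqualRowsVanish {Fin (suc n)} det zero (suc j)
  det-vanish₀ zero    A₀≋Aⱼ = det-vanish₀₁ A₀≋Aⱼ
  det-vanish₀ {suc n} (suc j) {A} A₀≋Aⱼ = begin
    det A     ≈⟨ swap-rows det-multilinear (λ ()) det-vanish₀₁ {A} {B} ≋-refl ≋-refl rest ⟩
    - det B   ≈⟨ -1*x≈-x _ ⟨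
    - 1# * det B
      ≈⟨ *-congˡ (minors-vanish λ k → det-vanish {i = zero} {suc j} (λ ()) (A₀≋Aⱼ ∘ punchIn k)) ⟩
    - 1# * 0# ≈⟨ zeroʳ _ ⟩
    0#        ∎
    where
    B : SquareMatrix (suc (suc n))
    B = A (suc zero) ∷ (A zero ∷ λ i → A (suc (suc i)))

    rest : ∀ k → k ≢ zero → k ≢ suc zero → A k ≋ B k
    rest zero          k≢0 _   = contradiction ≡.refl k≢0
    rest (suc zero)    _   k≢1 = contradiction ≡.refl k≢1
    rest (suc (suc k)) _   _   = ≋-refl

  det-vanish {_} {zero}  {zero}  0≢0 _     = contradiction ≡.refl 0≢0
  det-vanish {_} {zero}  {suc j} _   {A} Aᵢ≋Aⱼ = det-vanish₀ j {A} Aᵢ≋Aⱼ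
  det-vanish {_} {suc i} {zero}  _   {A} Aᵢ≋Aⱼ = det-vanish₀ i {A} (≋-sym Aᵢ≋Aⱼ)
  det-vanish {_} {suc i} {suc j} i≢j Aᵢ≋Aⱼ =
    minors-vanish λ k → det-vanish (i≢j ∘ ≡.cong suc) (Aᵢ≋Aⱼ ∘ punchIn k)

  -- Alternating forms are multiples of the determinant

  -- The identity matrix, by recursion, so that removing the first row and column gives `δ` again by
  -- computation.
  δ : ∀ {n} → SquareMatrix n
  δ zero    zero    = 1#
  δ zero    (suc j) = 0#
  δ (suc i) zero    = 0#
  δ (suc i) (suc j) = δ i j

  δ-refl : ∀ {n} (i : Fin n) → δ i i ≡ 1#
  δ-refl zero    = ≡.refl
  δ-refl (suc i) = δ-refl i

  δ-≢ : ∀ {n} {i j : Fin n} → i ≢ j → δ i j ≡ 0#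
  δ-≢ {_} {zero}  {zero}  i≢j = contradiction ≡.refl i≢j
  δ-≢ {_} {zero}  {suc j} i≢j = ≡.refl
  δ-≢ {_} {suc i} {zero}  i≢j = ≡.refl
  δ-≢ {_} {suc i} {suc j} i≢j = δ-≢ (i≢j ∘ ≡.cong suc)

  ∑-δˡ : ∀ {n} i (t : Vector Carrier n) → ∑ (λ j → δ i j * t j) ≈ t i
  ∑-δˡ i t = begin
    ∑ (λ j → δ i j * t j)
      ≈⟨ ∑-single i (λ j j≢i → trans (*-congʳ (reflexive (δ-≢ (j≢i ∘ ≡.sym)))) (zeroˡ _)) ⟩
    δ i i * t i            ≈⟨ *-congʳ (reflexive (δ-refl i)) ⟩
    1# * t i               ≈⟨ *-identityˡ _ ⟩
    t i                    ∎

  ∑-δʳ : ∀ {n} (t : Vector Carrier n) j → ∑ (λ i → t i * δ i j) ≈ t j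
  ∑-δʳ t j = begin
    ∑ (λ i → t i * δ i j)
      ≈⟨ ∑-single j (λ i i≢j → trans (*-congˡ (reflexive (δ-≢ i≢j))) (zeroʳ _)) ⟩
    t j * δ j j            ≈⟨ *-congˡ (reflexive (δ-refl j)) ⟩
    t j * 1#               ≈⟨ *-identityʳ _ ⟩
    t j                    ∎

  det-δ : ∀ {n} → det (δ {n}) ≈ 1#
  det-δ {zero}  = det-empty δ
  det-δ {suc n} = begin
    det δ                              ≈⟨ laplace δ ⟩
    ∑ _
      ≈⟨ ∑-single zero (λ { zero 0≢0 → contradiction ≡.refl 0≢0 ; (suc j) _ → trans (*-congˡ (zeroˡ _)) (zeroʳ _) }) ⟩
    1# * (1# * det (δ {n}))            ≈⟨ trans (*-identityˡ _) (*-identityˡ _) ⟩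
    det (δ {n})                        ≈⟨ det-δ {n} ⟩
    1#                                 ∎

  -- Rows are replaced one at a time from the top; the recursion keeps the replaced first row fixed
  -- and treats `f` as a function of the others.
  rowwise-invariance :
    ∀ {m n r} {_∼_ : Rel (Vector Carrier n) r}
    (f : (Fin m → Vector Carrier n) → Carrier) →
    (∀ {A B} → (∀ i → A i ≋ B i) → f A ≈ f B) →
    (∀ i {A B} → (∀ k → k ≢ i → A k ≋ B k) → A i ∼ B i → f A ≈ f B) →
    ∀ {A B} → (∀ i → A i ∼ B i) → f A ≈ f B
  rowwise-invariance {zero}  f f-cong f-∼ A∼B = f-cong λ ()
  rowwise-invariance {suc m} {_∼_ = _∼_} f f-cong f-∼ {A} {B} A∼B = begin
    f A
      ≈⟨ f-∼ zero {A} {B zero ∷ tail A} (λ { zero 0≢0 → contradiction ≡.refl 0≢0 ; (suc k) _ → ≋-refl }) (A∼B zero) ⟩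
    f (B zero ∷ tail A) ≈⟨ rowwise-invariance {_∼_ = _∼_} (λ C → f (B zero ∷ C))
                             (λ C≋D → f-cong λ { zero → ≋-refl ; (suc k) → C≋D k })
                             (λ i C≋D → f-∼ (suc i) λ { zero _ → ≋-refl ; (suc k) k≢i → C≋D k (k≢i ∘ ≡.cong suc) })
                             {tail A} {tail B} (A∼B ∘ suc) ⟩
    f (B zero ∷ tail B) ≈⟨ f-cong (λ { zero → ≋-refl ; (suc k) → ≋-refl }) ⟩
    f B                 ∎

  pad : ∀ {n} → Fin (suc n) → Vector Carrier n → Vector Carrier (suc n)
  pad j v = insertAt v j 0#

  pad-cong : ∀ {n} j {u v : Vector Carrier n} → u ≋ v → pad j u ≋ pad j v
  pad-cong         zero    u≋v zero    = refl
  pad-cong         zero    u≋v (suc k) = u≋v k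
  pad-cong {suc n} (suc j) u≋v zero    = u≋v zero
  pad-cong {suc n} (suc j) u≋v (suc k) = pad-cong j (u≋v ∘ suc) k

  pad-linear : ∀ {n} j a {u v w : Vector Carrier n} → (∀ k → w k ≈ a * u k + v k) →
               ∀ k → pad j w k ≈ a * pad j u k + pad j v k
  pad-linear         zero    a w≈ zero    = sym (trans (+-identityʳ _) (zeroʳ a))
  pad-linear         zero    a w≈ (suc k) = w≈ k
  pad-linear {suc n} (suc j) a w≈ zero    = w≈ zero
  pad-linear {suc n} (suc j) a w≈ (suc k) = pad-linear j a (w≈ ∘ suc) k

  pad-δ : ∀ {n} j (i : Fin n) → pad j (δ i) ≋ δ (punchIn j i)
  pad-δ         zero    i       zero    = refl
  pad-δ         zero    i       (suc k) = refl
  pad-δ {suc n} (suc j) zero    zero    = refl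
  pad-δ {suc n} (suc j) (suc i) zero    = refl
  pad-δ {suc n} (suc j) zero    (suc k) = pad-zero j k
    where
    pad-zero : ∀ {n} (j : Fin (suc n)) k → pad j (λ _ → 0#) k ≈ 0#
    pad-zero         zero    zero    = refl
    pad-zero         zero    (suc k) = refl
    pad-zero {suc n} (suc j) zero    = refl
    pad-zero {suc n} (suc j) (suc k) = pad-zero j k
  pad-δ {suc n} (suc j) (suc i) (suc k) = pad-δ j i k

  split-column : ∀ {n} j (v : Vector Carrier (suc n)) k →
                 v k ≈ v j * δ j k + pad j (removeAt v j) k
  split-column         zero    v zero    = sym (trans (+-identityʳ _) (*-identityʳ _))
  split-column         zero    v (suc k) = sym (trans (+-congʳ (zeroʳ _)) (+-identityˡ _))
  split-column {suc n} (suc j) v zero    = sym (trans (+-congʳ (zeroʳ _)) (+-identityˡ _))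
  split-column {suc n} (suc j) v (suc k) = split-column j (v ∘ suc) k

  ∷-off : ∀ {m n} {u : Vector Carrier n} {A B : Fin m → Vector Carrier n} {i} →
          (∀ k → k ≢ i → A k ≋ B k) → ∀ k → k ≢ suc i → (u ∷ A) k ≋ (u ∷ B) k
  ∷-off A≋B zero    _   = ≋-refl
  ∷-off A≋B (suc k) k≢i = A≋B k (k≢i ∘ ≡.cong suc)

  ∷-cong : ∀ {m n} {u v : Vector Carrier n} {A B : Fin m → Vector Carrier n} →
           u ≋ v → (∀ k → A k ≋ B k) → ∀ k → (u ∷ A) k ≋ (v ∷ B) k
  ∷-cong u≋v A≋B zero    = u≋v
  ∷-cong u≋v A≋B (suc k) = A≋B k

  combination-row : ∀ {m n r} {f : (Fin (suc m) → Vector Carrier n) → Carrier} → Multilinear f →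
                    ∀ (a : Vector Carrier r) (v : Fin r → Vector Carrier n) B →
                    f ((λ k → ∑ λ j → a j * v j k) ∷ B) ≈ ∑ λ j → a j * f (v j ∷ B)
  combination-row {r = zero} multilinear a v B =
    trans (zero-row zero λ k → ∑-empty _) (sym (∑-empty _))
    where open Multilinear multilinear
  combination-row {r = suc r} {f} multilinear a v B = begin
    f ((λ k → ∑ λ j → a j * v j k) ∷ B)
      ≈⟨ linear zero (a zero) off off (λ k → ∑-suc _) ⟩
    a zero * f (v zero ∷ B) + f ((λ k → ∑ λ j → a (suc j) * v (suc j) k) ∷ B)
      ≈⟨ +-congˡ (combination-row multilinear (a ∘ suc) (v ∘ suc) B) ⟩
    a zero * f (v zero ∷ B) + ∑ (λ j → a (suc j) * f (v (suc j) ∷ B))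
      ≈⟨ ∑-suc _ ⟨
    ∑ (λ j → a j * f (v j ∷ B)) ∎
    where
    open Multilinear multilinear
    off : ∀ {u w : Vector Carrier _} k → k ≢ zero → (u ∷ B) k ≋ (w ∷ B) k
    off zero    0≢0 = contradiction ≡.refl 0≢0
    off (suc k) _   = ≋-refl

  module _ {n} {f : SquareMatrix (suc n) → Carrier} (alternating : Alternating f) where
    open Alternating alternating

    -- Subtracting a multiple of `δ j` from a later row changes nothing, because the form vanishes
    -- once that row equals the first row `δ j`. The multiple is chosen to clear entry `j`.
    clear-column : ∀ j (B : Fin n → Vector Carrier (suc n)) →
                   f (δ j ∷ B) ≈ f (δ j ∷ λ i → pad j (removeAt (B i) j))
    clear-column j B = rowwise-invariance {_∼_ = λ u v → ∃ λ a → ∀ k → u k ≈ a * δ j k + v k}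
      (λ C → f (δ j ∷ C)) (λ C≋D → cong (∷-cong ≋-refl C≋D))
      (λ { i {A} {C} A≋C (a , row) → begin
        f (δ j ∷ A)
          ≈⟨ linear (suc i) a {δ j ∷ updateAt A i (const (δ j))} {δ j ∷ C}
               (∷-off λ k k≢i → ≋-reflexive (updateAt-minimal k i A k≢i))
               (∷-off λ k k≢i → ≋-sym (A≋C k k≢i))
               (λ k → trans (row k) (+-congʳ (*-congˡ (reflexive (≡.cong-app (≡.sym (updateAt-updates i A)) k))))) ⟩
        a * f (δ j ∷ updateAt A i (const (δ j))) + f (δ j ∷ C)
          ≈⟨ +-congʳ (*-congˡ (vanish {zero} {suc i} (λ ()) (≋-reflexive (≡.sym (updateAt-updates i A))))) ⟩
        a * 0# + f (δ j ∷ C)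
          ≈⟨ trans (+-congʳ (zeroʳ a)) (+-identityˡ _) ⟩
        f (δ j ∷ C) ∎ })
      λ i → B i j , split-column j (B i)

    -- Lowers the size by one, giving the form to which `alternating-unique` is applied recursively.
    bordered-alternating : ∀ j → Alternating {n} λ C → f (δ j ∷ λ i → pad j (C i))
    bordered-alternating j = record
      { multilinear = record
        { cong   = λ A≋B → cong (∷-cong ≋-refl (λ i → pad-cong j (A≋B i)))
        ; linear = λ i a A≋M B≋M row → linear (suc i) a
            (∷-off λ k k≢i → pad-cong j (A≋M k k≢i))
            (∷-off λ k k≢i → pad-cong j (B≋M k k≢i))
            (pad-linear j a row)
        }
      ; vanish = λ {i} {k} i≢k Aᵢ≋Aₖ → vanish {suc i} {suc k} (i≢k ∘ suc-injective) (pad-cong j Aᵢ≋Aₖ)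
      }

  -- The sign of a cycle by induction: passing from `inject₁ j` to `suc j` exchanges the first row
  -- with row `suc j` and leaves the others alone.
  cycle-rows : ∀ {n} {f : SquareMatrix (suc n) → Carrier} → Alternating f → ∀ j →
               f (δ j ∷ (δ ∘ punchIn j)) ≈ (- 1#) ^ toℕ j * f δ
  cycle-rows {n} {f} alternating = <-weakInduction _
    (trans (cong λ { zero → ≋-refl ; (suc k) → ≋-refl }) (sym (*-identityˡ _)))
    λ j ih → begin
      f (rows (suc j))
        ≈⟨ swap-rows multilinear {zero} {suc j} (λ ()) (vanish λ ()) {rows (suc j)} {rows (inject₁ j)}
             (≋-reflexive (≡.cong δ (≡.sym (punchIn-inject₁ j)))) (≋-reflexive (≡.cong δ (punchIn-suc j)))
             (λ { zero 0≢0 _ → contradiction ≡.refl 0≢0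
                ; (suc k) _ k≢j → ≋-reflexive (≡.cong δ (punchIn-adjacent j k (k≢j ∘ ≡.cong suc))) }) ⟩
      - f (rows (inject₁ j))
        ≈⟨ -‿cong ih ⟩
      - ((- 1#) ^ toℕ (inject₁ j) * f δ)
        ≈⟨ -1*x≈-x _ ⟨
      - 1# * ((- 1#) ^ toℕ (inject₁ j) * f δ)
        ≈⟨ *-assoc _ _ _ ⟨
      (- 1#) ^ suc (toℕ (inject₁ j)) * f δ
        ≡⟨ ≡.cong (λ t → (- 1#) ^ suc t * f δ) (toℕ-inject₁ j) ⟩
      (- 1#) ^ toℕ (suc j) * f δ ∎
    where
    open Alternating alternating

    rows : Fin (suc n) → SquareMatrix (suc n)
    rows j = δ j ∷ (δ ∘ punchIn j)

    punchIn-inject₁ : ∀ {n} (j : Fin n) → punchIn (inject₁ j) j ≡ suc j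
    punchIn-inject₁ zero    = ≡.refl
    punchIn-inject₁ (suc j) = ≡.cong suc (punchIn-inject₁ j)

    punchIn-suc : ∀ {n} (j : Fin n) → punchIn (suc j) j ≡ inject₁ j
    punchIn-suc zero    = ≡.refl
    punchIn-suc (suc j) = ≡.cong suc (punchIn-suc j)

    punchIn-adjacent : ∀ {n} (j k : Fin n) → k ≢ j → punchIn (suc j) k ≡ punchIn (inject₁ j) k
    punchIn-adjacent zero    zero    k≢j = contradiction ≡.refl k≢j
    punchIn-adjacent zero    (suc k) k≢j = ≡.refl
    punchIn-adjacent (suc j) zero    k≢j = ≡.refl
    punchIn-adjacent (suc j) (suc k) k≢j = ≡.cong suc (punchIn-adjacent j k (k≢j ∘ ≡.cong suc))

  -- Expand the first row in unit vectors. For each `j`, clear column `j`, apply the claim to the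
  -- bordered form, and reorder the unit rows at the cost of (-1)^j; what results is the Laplace
  -- expansion of `det A` times `f δ`.
  alternating-unique : ∀ {n} {f : SquareMatrix n → Carrier} → Alternating f →
                       ∀ A → f A ≈ det A * f δ
  alternating-unique {zero} {f} alternating A = begin
    f A           ≈⟨ cong (λ ()) ⟩
    f δ           ≈⟨ *-identityˡ _ ⟨
    1# * f δ      ≈⟨ *-congʳ (det-empty A) ⟨
    det A * f δ   ∎
    where open Alternating alternating
  alternating-unique {suc n} {f} alternating A = begin
    f A
      ≈⟨ cong (λ { zero k → sym (∑-δʳ (A zero) k) ; (suc i) → ≋-refl }) ⟩
    f ((λ k → ∑ λ j → A zero j * δ j k) ∷ tail A)
      ≈⟨ combination-row multilinear (A zero) δ (tail A) ⟩
    ∑ (λ j → A zero j * f (δ j ∷ tail A))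
      ≈⟨ ∑-cong (λ j → *-congˡ (expand j)) ⟩
    ∑ (λ j → A zero j * (minor j * ((- 1#) ^ toℕ j * f δ)))
      ≈⟨ ∑-cong (λ j → solve 4 (λ a d s e → a :* (d :* (s :* e)) := (s :* (a :* d)) :* e) refl (A zero j) (minor j) ((- 1#) ^ toℕ j) (f δ)) ⟩
    ∑ (λ j → (- 1#) ^ toℕ j * (A zero j * minor j) * f δ)
      ≈⟨ ∑-*ʳ (f δ) _ ⟨
    ∑ (λ j → (- 1#) ^ toℕ j * (A zero j * minor j)) * f δ
      ≈⟨ *-congʳ (laplace A) ⟨
    det A * f δ ∎
    where
    open Alternating alternating

    minor : Fin (suc n) → Carrier
    minor j = det λ i → removeAt (A (suc i)) j

    expand : ∀ j → f (δ j ∷ tail A) ≈ minor j * ((- 1#) ^ toℕ j * f δ)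
    expand j = begin
      f (δ j ∷ tail A)
        ≈⟨ clear-column alternating j (tail A) ⟩
      f (δ j ∷ λ i → pad j (removeAt (A (suc i)) j))
        ≈⟨ alternating-unique (bordered-alternating alternating j) (λ i → removeAt (A (suc i)) j) ⟩
      minor j * f (δ j ∷ λ i → pad j (δ i))
        ≈⟨ *-congˡ (cong (∷-cong ≋-refl (pad-δ j))) ⟩
      minor j * f (δ j ∷ (δ ∘ punchIn j))
        ≈⟨ *-congˡ (cycle-rows alternating j) ⟩
      minor j * ((- 1#) ^ toℕ j * f δ) ∎

  -- Block matrices

  stack : ∀ {k m n} → (Fin m → Vector Carrier n) → (Fin k × Fin m → Vector Carrier n) →
          Fin (suc k) × Fin m → Vector Carrier n
  stack Z A (zero  , r) = Z r
  stack Z A (suc t , r) = A (t , r)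

  -- With the other blocks held fixed, `F` is alternating in the rows of block zero, so a
  -- determinant splits off and that block becomes the identity. Induction handles the remaining
  -- blocks.
  blockwise-unique :
    ∀ {k n} {F : (Fin k × Fin n → Vector Carrier n) → Carrier} → Multilinear F →
    (∀ t {r s} → r ≢ s → EqualRowsVanish F (t , r) (t , s)) →
    ∀ A → F A ≈ product (λ t → det λ r → A (t , r)) * F (λ (_ , r) → δ r)
  blockwise-unique {zero} multilinear vanish A =
    trans (Multilinear.cong multilinear λ ()) (sym (*-identityˡ _))
  blockwise-unique {suc k} {n} {F} multilinear vanish A = begin
    F A
      ≈⟨ cong (λ { (zero , r) → ≋-refl ; (suc t , r) → ≋-refl }) ⟩
    F (stack (λ r → A (zero , r)) A′)
      ≈⟨ alternating-unique first (λ r → A (zero , r)) ⟩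
    det (λ r → A (zero , r)) * F (stack δ A′)
      ≈⟨ *-congˡ (blockwise-unique rest (λ t r≢s → vanish (suc t) r≢s) A′) ⟩
    det (λ r → A (zero , r)) * (product (λ t → det λ r → A (suc t , r)) * F (stack δ λ (_ , r) → δ r))
      ≈⟨ *-assoc _ _ _ ⟨
    product (λ t → det λ r → A (t , r)) * F (stack δ λ (_ , r) → δ r)
      ≈⟨ *-congˡ (cong λ { (zero , r) → ≋-refl ; (suc t , r) → ≋-refl }) ⟩
    product (λ t → det λ r → A (t , r)) * F (λ (_ , r) → δ r) ∎
    where
    open Multilinear multilinear

    A′ : Fin k × Fin n → Vector Carrier n
    A′ (t , r) = A (suc t , r)

    first : Alternating λ Z → F (stack Z A′)
    first = record
      { multilinear = record
        { cong   = λ Z≋W → cong λ { (zero , r) → Z≋W r ; (suc t , r) → ≋-refl }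
        ; linear = λ i a Z≋V W≋V row → linear (zero , i) a
            (λ { (zero , r) r≢i → Z≋V r (r≢i ∘ ≡.cong (zero ,_)) ; (suc t , r) _ → ≋-refl })
            (λ { (zero , r) r≢i → W≋V r (r≢i ∘ ≡.cong (zero ,_)) ; (suc t , r) _ → ≋-refl })
            row
        }
      ; vanish = λ i≢j Zᵢ≋Zⱼ → vanish zero i≢j Zᵢ≋Zⱼ
      }

    rest : Multilinear λ B → F (stack δ B)
    rest = record
      { cong   = λ B≋C → cong λ { (zero , r) → ≋-refl ; (suc t , r) → B≋C (t , r) }
      ; linear = λ (t , i) a B≋D C≋D row → linear (suc t , i) a
          (λ { (zero , r) _ → ≋-refl ; (suc u , r) ≢ti → B≋D (u , r) λ { ≡.refl → ≢ti ≡.refl } })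
          (λ { (zero , r) _ → ≋-refl ; (suc u , r) ≢ti → C≋D (u , r) λ { ≡.refl → ≢ti ≡.refl } })
          row
      }

  module _ {K k n} (ρ : Fin K ↔ (Fin k × Fin n)) where
    open Inverse ρ using (to; from; strictlyInverseˡ; strictlyInverseʳ)

    private
      -- Row `p` of diag(A) · W: only the rows of `W` in the block of `p` enter. Equal coefficient
      -- vectors within one block therefore give equal rows, which makes the determinant alternating
      -- blockwise.
      row : (Fin k × Fin n → Vector Carrier n) → SquareMatrix K →
            Fin k × Fin n → Vector Carrier K
      row A W p b = ∑ λ i → A p i * W (from (proj₁ p , i)) b

    -- det (diag(Y₁, …, Y_k) · W), with the K rows grouped into k blocks by ρ.
    det-blockwise : (Y : Fin k → SquareMatrix n) (W : SquareMatrix K) →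
      det (λ a b → ∑ λ i → Y (proj₁ (to a)) (proj₂ (to a)) i * W (from (proj₁ (to a) , i)) b)
        ≈ product (λ t → det (Y t)) * det W
    det-blockwise Y W = begin
      F (λ (t , r) → Y t r)
        ≈⟨ blockwise-unique multilinear vanish (λ (t , r) → Y t r) ⟩
      product (λ t → det (Y t)) * F (λ (_ , r) → δ r)
        -- Identity blocks select exactly the rows of `W`.
        ≈⟨ *-congˡ (det-cong λ a b → trans (∑-δˡ _ _) (reflexive (≡.cong (λ a → W a b) (strictlyInverseʳ a)))) ⟩
      product (λ t → det (Y t)) * det W ∎
      where
      F : (Fin k × Fin n → Vector Carrier n) → Carrier
      F A = det (row A W ∘ to)

      row-cong : ∀ {A B p} → A p ≋ B p → row A W p ≋ row B W p
      row-cong Ap≋Bp b = ∑-cong λ i → *-congʳ (Ap≋Bp i)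

      -- The index `q` stands for `to (from p)`, which equals `p` only propositionally.
      row-linear : ∀ {p} a {A B M} → (∀ j → M p j ≈ a * A p j + B p j) →
                   ∀ {q} → q ≡ p → ∀ b → row M W q b ≈ a * row A W q b + row B W q b
      row-linear {p} a {A} {B} {M} Mp≈ ≡.refl b = begin
        ∑ (λ i → M p i * w i)
          ≈⟨ ∑-cong (λ i → trans (*-congʳ (Mp≈ i)) (trans (distribʳ _ _ _) (+-congʳ (*-assoc _ _ _)))) ⟩
        ∑ (λ i → a * (A p i * w i) + B p i * w i)                   ≈⟨ ∑-+ _ _ ⟩
        ∑ (λ i → a * (A p i * w i)) + row B W p b                   ≈⟨ +-congʳ (∑-*ˡ a _) ⟨
        a * row A W p b + row B W p b                               ∎
        where
        w : Fin n → Carrier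
        w i = W (from (proj₁ p , i)) b

      ≢-to : ∀ {a p} → a ≢ from p → to a ≢ p
      ≢-to a≢ to-a≡p = a≢ (≡.trans (≡.sym (strictlyInverseʳ _)) (≡.cong from to-a≡p))

      multilinear : Multilinear F
      multilinear = record
        { cong   = λ {A} {B} A≋B → det-cong λ a → row-cong {A} {B} (A≋B (to a))
        ; linear = λ p a {A} {B} {M} A≋M B≋M Mp≈ → det-linear (from p) a
            (λ c c≢ → row-cong {A} {M} (A≋M (to c) (≢-to c≢)))
            (λ c c≢ → row-cong {B} {M} (B≋M (to c) (≢-to c≢)))
            (row-linear a {A} {B} {M} Mp≈ (strictlyInverseˡ p))
        }

      vanish : ∀ t {r s} → r ≢ s → EqualRowsVanish F (t , r) (t , s)
      vanish t {r} {s} r≢s {A} Ar≋As = det-vanish {i = from (t , r)} {from (t , s)} from≢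
        (equal (strictlyInverseˡ (t , r)) (strictlyInverseˡ (t , s)))
        where
        from≢ : from (t , r) ≢ from (t , s)
        from≢ eq = r≢s (≡.cong proj₂ (≡.trans (≡.sym (strictlyInverseˡ _))
          (≡.trans (≡.cong to eq) (strictlyInverseˡ _))))

        equal : ∀ {p q} → p ≡ (t , r) → q ≡ (t , s) → row A W p ≋ row A W q
        equal ≡.refl ≡.refl b = ∑-cong λ i → *-congʳ (Ar≋As i)

    -- The identity of size `K` is the Kronecker product of the identities of sizes `k` and `n`,
    -- read through `ρ`. It brings I ⊗ L into the shape that `det-blockwise` expects.
    δ-from : ∀ t r b → δ (from (t , r)) b ≈ δ t (proj₁ (to b)) * δ r (proj₂ (to b))
    δ-from t r b with t ≟ proj₁ (to b) | r ≟ proj₂ (to b)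
    ... | yes ≡.refl | yes ≡.refl = trans
      (reflexive (≡.trans (≡.cong (λ a → δ a b) (strictlyInverseʳ b)) (δ-refl b)))
      (sym (trans (*-cong (reflexive (δ-refl (proj₁ (to b)))) (reflexive (δ-refl (proj₂ (to b))))) (*-identityˡ _)))
    ... | no t≢ | _ = trans
      (reflexive (δ-≢ {i = from (t , r)} {b} λ { ≡.refl → t≢ (≡.cong proj₁ (≡.sym (strictlyInverseˡ (t , r)))) }))
      (sym (trans (*-congʳ (reflexive (δ-≢ t≢))) (zeroˡ _)))
    ... | yes _ | no r≢ = trans
      (reflexive (δ-≢ {i = from (t , r)} {b} λ { ≡.refl → r≢ (≡.cong proj₂ (≡.sym (strictlyInverseˡ (t , r)))) }))
      (sym (trans (*-congˡ (reflexive (δ-≢ r≢))) (zeroʳ _)))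

  -- Determinants of the triangular factors

  -- The first summand of the expansion has a zero entry; every other minor still contains the zero
  -- column.
  det-zero-column : ∀ {n} {A : SquareMatrix (suc n)} → (∀ i → A i zero ≈ 0#) → det A ≈ 0#
  det-zero-column {n} {A} A≈0 = trans (laplace A) (∑-zero (term {A = A} A≈0))
    where
    term : ∀ {n} {A : SquareMatrix (suc n)} → (∀ i → A i zero ≈ 0#) → ∀ j →
           (- 1#) ^ toℕ j * (A zero j * det (λ i → removeAt (A (suc i)) j)) ≈ 0#
    term A≈0 zero = trans (*-congˡ (trans (*-congʳ (A≈0 zero)) (zeroˡ _))) (zeroʳ _)
    term {suc n} A≈0 (suc j) =
      trans (*-congˡ (trans (*-congˡ (det-zero-column (A≈0 ∘ suc))) (zeroʳ _))) (zeroʳ _)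

  -- The factor `U`: the indicator of i ≤ j.
  step : ∀ {n} → SquareMatrix n
  step zero    _       = 1#
  step (suc i) zero    = 0#
  step (suc i) (suc j) = step i j

  -- The factor `L`: ones on and below the antidiagonal.
  antistep : ∀ {n} → SquareMatrix n
  antistep i j = step (opposite j) i

  step-zeroʳ : ∀ {n} {i : Fin (suc n)} → i ≢ zero → step i zero ≡ 0#
  step-zeroʳ {i = zero}  0≢0 = contradiction ≡.refl 0≢0
  step-zeroʳ {i = suc i} _   = ≡.refl

  det-step : ∀ n → det (step {n}) ≈ 1#
  det-step zero    = det-empty step
  det-step (suc n) = begin
    det (step {suc n})             ≈⟨ laplace step ⟩
    ∑ _                            ≈⟨ ∑-single zero (term n) ⟩
    1# * (1# * det (step {n}))     ≈⟨ trans (*-identityˡ _) (*-identityˡ _) ⟩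
    det (step {n})                 ≈⟨ det-step n ⟩
    1#                             ∎
    where
    term : ∀ n (j : Fin (suc n)) → j ≢ zero →
           (- 1#) ^ toℕ j * (1# * det (λ i → removeAt (step (suc i)) j)) ≈ 0#
    term n       zero    0≢0 = contradiction ≡.refl 0≢0
    -- Deleting a later column keeps column zero, which is zero below the first row.
    term (suc n) (suc j) _   =
      trans (*-congˡ (trans (*-congˡ (det-zero-column λ _ → refl)) (zeroʳ _))) (zeroʳ _)

  punchIn-fromℕ : ∀ {n} (i : Fin n) → punchIn (fromℕ n) i ≡ inject₁ i
  punchIn-fromℕ zero    = ≡.refl
  punchIn-fromℕ (suc i) = ≡.cong suc (punchIn-fromℕ i)

  opposite-inject₁ : ∀ {n} (i : Fin n) → opposite (inject₁ i) ≡ suc (opposite i)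
  opposite-inject₁ zero    = ≡.refl
  opposite-inject₁ (suc i) = ≡.cong inject₁ (opposite-inject₁ i)

  -- The first row is zero except for its last entry, in position `n`; deleting that row and column
  -- leaves the next smaller matrix of the same kind.
  det-antistep-suc : ∀ n → det (antistep {suc n}) ≈ (- 1#) ^ n * det (antistep {n})
  det-antistep-suc n = begin
    det (antistep {suc n})
      ≈⟨ laplace antistep ⟩
    ∑ (λ j → (- 1#) ^ toℕ j * (step (opposite j) zero * minor j))
      ≈⟨ ∑-single (fromℕ n) (λ j j≢n → trans (*-congˡ (trans (*-congʳ (reflexive (step-zeroʳ (j≢n ∘ opposite≡0 j)))) (zeroˡ _))) (zeroʳ _)) ⟩
    (- 1#) ^ toℕ (fromℕ n) * (step (opposite (fromℕ n)) zero * minor (fromℕ n))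
      ≡⟨ ≡.cong₂ (λ t i → (- 1#) ^ t * (step i zero * minor (fromℕ n))) (toℕ-fromℕ n) (opposite-involutive {suc n} zero) ⟩
    (- 1#) ^ n * (1# * minor (fromℕ n))
      ≈⟨ *-congˡ (trans (*-identityˡ _) (det-cong λ i j → reflexive (≡.cong (λ k → step k (suc i)) (≡.trans (≡.cong opposite (punchIn-fromℕ j)) (opposite-inject₁ j))))) ⟩
    (- 1#) ^ n * det (antistep {n}) ∎
    where
    minor : Fin (suc n) → Carrier
    minor j = det λ i → removeAt (antistep (suc i)) j

    opposite≡0 : ∀ j → opposite j ≡ zero → j ≡ fromℕ n
    opposite≡0 j eq = ≡.trans (≡.sym (opposite-involutive j)) (≡.cong opposite eq)

  [-1]² : - 1# * - 1# ≈ 1#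
  [-1]² = trans (-1*x≈-x _) (⁻¹-involutive 1#)

  [-1]^n-square : ∀ n → (- 1#) ^ n * (- 1#) ^ n ≈ 1#
  [-1]^n-square zero    = *-identityˡ 1#
  [-1]^n-square (suc n) = begin
    (- 1# * s) * (- 1# * s)
      ≈⟨ solve 2 (λ e s → (e :* s) :* (e :* s) := (e :* e) :* (s :* s)) refl (- 1#) s ⟩
    (- 1# * - 1#) * (s * s)    ≈⟨ *-cong [-1]² ([-1]^n-square n) ⟩
    1# * 1#                    ≈⟨ *-identityˡ 1# ⟩
    1#                         ∎
    where
    s : Carrier
    s = (- 1#) ^ n

  -- The signs of two successive expansions have exponents n + 1 and n, with product - 1# for every
  -- n. Hence the recursion in steps of two, separately for each parity.
  det-antistep-suc² : ∀ n → det (antistep {suc (suc n)}) ≈ - 1# * det (antistep {n})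
  det-antistep-suc² n = begin
    det (antistep {suc (suc n)})
      ≈⟨ trans (det-antistep-suc (suc n)) (*-congˡ (det-antistep-suc n)) ⟩
    (- 1# * s) * (s * d)
      ≈⟨ solve 3 (λ e s d → (e :* s) :* (s :* d) := e :* ((s :* s) :* d)) refl (- 1#) s d ⟩
    - 1# * ((s * s) * d)
      ≈⟨ *-congˡ (trans (*-congʳ ([-1]^n-square n)) (*-identityˡ d)) ⟩
    - 1# * d                                  ∎
    where
    s d : Carrier
    s = (- 1#) ^ n
    d = det (antistep {n})

  det-antistep-even : ∀ k → det (antistep {k *ℕ 2}) ≈ (- 1#) ^ k
  det-antistep-even zero    = det-empty antistep
  det-antistep-even (suc k) = trans (det-antistep-suc² (k *ℕ 2)) (*-congˡ (det-antistep-even k))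

  det-antistep-odd : ∀ k → det (antistep {suc (k *ℕ 2)}) ≈ (- 1#) ^ k
  det-antistep-odd zero    = trans (det-antistep-suc 0) (trans (*-identityˡ _) (det-empty antistep))
  det-antistep-odd (suc k) = trans (det-antistep-suc² (suc (k *ℕ 2))) (*-congˡ (det-antistep-odd k))

  -- The matrix C(N, m)

  step-absorbs : ∀ {n} {p q : Fin n} → p ≤ᶠ q → ∀ i → step p i * step q i ≈ step q i
  step-absorbs {p = zero}                 p≤q       i       = *-identityˡ _
  step-absorbs {p = suc p} {q = suc q}    p≤q       zero    = zeroˡ _
  step-absorbs {p = suc p} {q = suc q}    (s≤s p≤q) (suc i) = step-absorbs p≤q i

  -- A maximum is at most `i` exactly when both arguments are. This separates the row index from the
  -- column index in the entries of `C`.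
  step-⊔ : ∀ {n} (p q i : Fin n) → step (Max._⊔_ (≤-totalOrder n) p q) i ≈ step p i * step q i
  step-⊔ {n} p q i with ≤-total p q
  ... | inj₁ p≤q = trans (reflexive (≡.cong (λ u → step u i) (Max.x≤y⇒x⊔y≈y (≤-totalOrder n) p≤q)))
                         (sym (step-absorbs p≤q i))
  ... | inj₂ q≤p = trans (reflexive (≡.cong (λ u → step u i) (Max.x≤y⇒y⊔x≈y (≤-totalOrder n) q≤p)))
                         (sym (trans (*-comm _ _) (step-absorbs q≤p i)))

  -- The factor `step u i` discards the differences before position `u`, so the sum telescopes from
  -- there.
  telescope : ∀ {m} (u : Fin m) (y : Vector Carrier (suc m)) →
              ∑ (λ i → step u i * (y (inject₁ i) - y (suc i))) ≈ y (inject₁ u) - y (fromℕ m)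
  telescope {suc zero} zero y =
    trans (∑-suc _) (trans (+-cong (*-identityˡ _) (∑-empty _)) (+-identityʳ _))
  telescope {suc (suc m)} zero y = begin
    ∑ (λ i → 1# * (y (inject₁ i) - y (suc i)))       ≈⟨ ∑-suc _ ⟩
    1# * (y₀ - y₁) + ∑ (λ i → 1# * (y (suc (inject₁ i)) - y (suc (suc i))))
      ≈⟨ +-cong (*-identityˡ _) (telescope zero (y ∘ suc)) ⟩
    (y₀ - y₁) + (y₁ - yₗ)                            ≈⟨ +-assoc _ _ _ ⟩
    y₀ + (- y₁ + (y₁ - yₗ))                          ≈⟨ +-congˡ (+-assoc _ _ _) ⟨
    y₀ + ((- y₁ + y₁) - yₗ)
      ≈⟨ +-congˡ (trans (+-congʳ (-‿inverseˡ y₁)) (+-identityˡ _)) ⟩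
    y₀ - yₗ                                          ∎
    where
    y₀ y₁ yₗ : Carrier
    y₀ = y zero
    y₁ = y (suc zero)
    yₗ = y (fromℕ (suc (suc m)))
  telescope {suc m} (suc u) y = trans (∑-suc _)
    (trans (+-cong (zeroˡ _) (telescope u (y ∘ suc))) (+-identityˡ _))

  C-factorisation : ∀ {m} (x : Vector Carrier m) p q →
    C x p q ≈ ∑ λ i → step p i * ((extend x (inject₁ i) - extend x (suc i)) * antistep i q)
  C-factorisation {m} x p q = begin
    x u
      ≡⟨ ≡.trans (≡.cong (extend x) (≡.sym (punchIn-fromℕ u))) (insertAt-punchIn x (fromℕ m) 0# u) ⟨
    extend x (inject₁ u)
      -- The appended value x_{m+1} = 0 is the end term of the telescoping sum.
      ≈⟨ trans (+-congˡ (trans (-‿cong (reflexive (insertAt-lookup x (fromℕ m) 0#))) ε⁻¹≈ε)) (+-identityʳ _) ⟨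
    extend x (inject₁ u) - extend x (fromℕ m)
      ≈⟨ telescope u (extend x) ⟨
    ∑ (λ i → step u i * d i)
      ≈⟨ ∑-cong (λ i → *-congʳ (step-⊔ p (opposite q) i)) ⟩
    ∑ (λ i → (step p i * antistep i q) * d i)
      ≈⟨ ∑-cong (λ i → trans (*-assoc _ _ _) (*-congˡ (*-comm _ _))) ⟩
    ∑ (λ i → step p i * (d i * antistep i q)) ∎
    where
    u : Fin m
    u = Max._⊔_ (≤-totalOrder m) p (opposite q)
    d : Fin m → Carrier
    d i = extend x (inject₁ i) - extend x (suc i)

  product-one : ∀ {n} {t : Vector Carrier n} → (∀ i → t i ≈ 1#) → product t ≈ 1#
  product-one {zero}  t≈1 = refl
  product-one {suc n} t≈1 = trans (*-cong (t≈1 zero) (product-one (t≈1 ∘ suc))) (*-identityˡ 1#)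

  det-CN : ∀ {N m} (x : Fin N → Fin N → Vector Carrier m) →
           det (CN x) ≈ det (antistep {m}) ^ N * product (λ i → det (X x i))
  det-CN {N} {m} x = begin
    det (CN x)
      -- Writes the matrix as (I ⊗ U) · `W₁`, where `W₁` = D · (I ⊗ L).
      ≈⟨ det-cong (λ a b → trans (C-factorisation _ _ _) (∑-cong λ i → *-congˡ (reflexive (≡.cong (λ a → middle a (to b)) (≡.sym (strictlyInverseˡ _)))))) ⟩
    det (λ a b → ∑ λ i → step (proj₂ (to a)) i * W₁ (from (proj₁ (to a) , i)) b)
      ≈⟨ det-blockwise ρ (λ _ → step) W₁ ⟩
    product {N} (λ _ → det (step {m})) * det W₁
      ≈⟨ trans (*-congʳ (product-one {N} λ _ → det-step m)) (*-identityˡ _) ⟩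
    det W₁
      -- Inserting a sum against `δ` over the block index `s` exhibits `W₁` as D times `W₂` = I ⊗ L.
      ≈⟨ det-cong (λ a b → begin
           middle (to a) (to b)
             ≈⟨ *-congʳ (∑-δʳ _ _) ⟨
           ∑ (λ s → X x (proj₂ (to a)) (proj₁ (to a)) s * δ s (proj₁ (to b))) * antistep (proj₂ (to a)) (proj₂ (to b))
             ≈⟨ ∑-*ʳ _ _ ⟩
           ∑ (λ s → X x (proj₂ (to a)) (proj₁ (to a)) s * δ s (proj₁ (to b)) * antistep (proj₂ (to a)) (proj₂ (to b)))
             ≈⟨ ∑-cong (λ s → trans (*-assoc _ _ _) (*-congˡ (reflexive (≡.cong (λ a → right a (to b)) (≡.sym (strictlyInverseˡ _)))))) ⟩
           ∑ (λ s → X x (proj₂ (to a)) (proj₁ (to a)) s * W₂ (from (s , proj₂ (to a))) b) ∎) ⟩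
    det (λ a b → ∑ λ s → X x (proj₂ (to a)) (proj₁ (to a)) s * W₂ (from (s , proj₂ (to a))) b)
      -- Exchanging the coordinates groups the rows by `i`, so that the blocks of D are the `X x i`.
      ≈⟨ det-blockwise (×-comm _ _ ↔-∘ ρ) (X x) W₂ ⟩
    product (λ i → det (X x i)) * det W₂
      -- I ⊗ L is written as itself times the identity, so that the same lemma applies with `W` =
      -- `δ`.
      ≈⟨ *-congˡ (det-cong λ a b → begin
           δ (proj₁ (to a)) (proj₁ (to b)) * antistep (proj₂ (to a)) (proj₂ (to b))
             ≈⟨ *-congˡ (∑-δʳ _ _) ⟨
           δ (proj₁ (to a)) (proj₁ (to b)) * ∑ (λ i → antistep (proj₂ (to a)) i * δ i (proj₂ (to b)))
             ≈⟨ ∑-*ˡ _ _ ⟩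
           ∑ (λ i → δ (proj₁ (to a)) (proj₁ (to b)) * (antistep (proj₂ (to a)) i * δ i (proj₂ (to b))))
             ≈⟨ ∑-cong (λ i → trans (solve 3 (λ d l e → d :* (l :* e) := l :* (d :* e)) refl _ _ _) (*-congˡ (sym (δ-from ρ _ _ b)))) ⟩
           ∑ (λ i → antistep (proj₂ (to a)) i * δ (from (proj₁ (to a) , i)) b) ∎) ⟩
    product (λ i → det (X x i)) * det (λ a b → ∑ λ i → antistep (proj₂ (to a)) i * δ (from (proj₁ (to a) , i)) b)
      ≈⟨ *-congˡ (det-blockwise ρ (λ _ → antistep) δ) ⟩
    product (λ i → det (X x i)) * (product {N} (λ _ → det (antistep {m})) * det (δ {N *ℕ m}))
      ≈⟨ *-congˡ (trans (*-cong (product-replicate N) (det-δ {N *ℕ m})) (*-identityʳ _)) ⟩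
    product (λ i → det (X x i)) * det (antistep {m}) ^ N
      ≈⟨ *-comm _ _ ⟩
    det (antistep {m}) ^ N * product (λ i → det (X x i)) ∎
    where
    ρ : Fin (N *ℕ m) ↔ (Fin N × Fin m)
    ρ = *↔×
    open Inverse ρ using (to; from; strictlyInverseˡ)

    middle right : Fin N × Fin m → Fin N × Fin m → Carrier
    middle (t , i) (s , q) = X x i t s * antistep i q
    right  (t , i) (s , q) = δ t s * antistep i q

    W₁ W₂ : SquareMatrix (N *ℕ m)
    W₁ a b = middle (to a) (to b)
    W₂ a b = right (to a) (to b)

  -- Collects the `N` equal signs into one power. The exponent `e` is kept apart from `k *ℕ N` so
  -- that an exponent written with division can be supplied.
  det-CN-sign : ∀ {N m} (x : Fin N → Fin N → Vector Carrier m) k e →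
                det (antistep {m}) ≈ (- 1#) ^ k → e ≡ k *ℕ N →
                Matrices.det R (CN x) ≈ (- 1#) ^ e * product (λ i → Matrices.det R (X x i))
  det-CN-sign {N} {m} x k e sign ≡.refl = begin
    Matrices.det R (CN x)
      ≡⟨ det-≡ (CN x) ⟩
    det (CN x)
      ≈⟨ det-CN x ⟩
    det (antistep {m}) ^ N * product (λ i → det (X x i))
      ≈⟨ *-cong (^-congˡ N sign) (product-cong {m} {λ i → det (X x i)} {λ i → Matrices.det R (X x i)} λ i → reflexive (≡.sym (det-≡ (X x i)))) ⟩
    ((- 1#) ^ k) ^ N * product (λ i → Matrices.det R (X x i))
      ≈⟨ *-congʳ (^-assocʳ (- 1#) k N) ⟩
    (- 1#) ^ (k *ℕ N) * product (λ i → Matrices.det R (X x i)) ∎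

-- Parity of m and the two cases

even⊎odd : ∀ m → (∃ λ k → m ≡ k *ℕ 2) ⊎ (∃ λ k → m ≡ suc (k *ℕ 2))
even⊎odd zero = inj₁ (0 , ≡.refl)
even⊎odd (suc m) with even⊎odd m
... | inj₁ (k , ≡.refl) = inj₂ (k , ≡.refl)
... | inj₂ (k , ≡.refl) = inj₁ (suc k , ≡.refl)

half : ∀ N k → (N *ℕ (k *ℕ 2)) / 2 ≡ k *ℕ N
half N k = ≡.trans (≡.cong (_/ 2) (≡.sym (ℕ.*-assoc N k 2))) (≡.trans (m*n/n≡m (N *ℕ k) 2) (ℕ.*-comm N k))

theorem2p3 : ∀ {c ℓ} (R : CommutativeRing c ℓ) →
    let open CommutativeRing R in let open Matrices R in
    (N m : ℕ) → 2 ≤ N → 1 ≤ m →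
    (x : Fin N → Fin N → Vector Carrier m) →
    (2 ∣ m → det (CN x) ≈ (- 1#) ^ ((N *ℕ m) / 2) * product (λ i → det (X x i)))
    × (2 ∤ m → det (CN x) ≈ (- 1#) ^ ((N *ℕ (m ∸ 1)) / 2) * product (λ i → det (X x i)))
theorem2p3 R N m _ _ x = even , odd m x
  where
  open CommutativeRing R using (_≈_; _*_; -_; 1#; Carrier)
  open Matrices R
  open Determinants R using (det-CN-sign; det-antistep-even; det-antistep-odd)

  even : 2 ∣ m → det (CN x) ≈ (- 1#) ^ ((N *ℕ m) / 2) * product (λ i → det (X x i))
  even (divides k ≡.refl) = det-CN-sign x k _ (det-antistep-even k) (half N k)

  odd : ∀ m (x : Fin N → Fin N → Vector Carrier m) → 2 ∤ m →
        det (CN x) ≈ (- 1#) ^ ((N *ℕ (m ∸ 1)) / 2) * product (λ i → det (X x i))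
  odd m x 2∤m with even⊎odd m
  ... | inj₁ (k , m≡k*2)  = contradiction (divides k m≡k*2) 2∤m
  -- Here `m` is `suc (k *ℕ 2)`, so `m ∸ 1` computes to `k *ℕ 2` and `half` gives the exponent as in
  -- the even case.
  ... | inj₂ (k , ≡.refl) = det-CN-sign x k _ (det-antistep-odd k) (half N k)
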